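{- The generating function for $\{213,321\}$-avoiding perfect matchings is $$\sum_{n\ge0}|\mathcal{M}_n(213,321)|z^{2n}=G(0,0,z),$$ where $G(t,u,z)$, a formal power series in $z$ with coefficients polynomials in $t$ and $u$, is the solution of the functional equation $$G(t,u,z)=1+z\Bigg(tG(t,u,z)+\frac{G(t,u,z)-G(t,0,z)}{tu}+\frac{G(t,0,z)-G(0,0,z)}{t}+\frac{tu}{1-u}\bigl(G(t,0,z)-G(tu,0,z)\bigr)\Bigg).$$
   Context: A perfect matching of $[2n]$ is a set of $n$ disjoint pairs $(i,j)$, $i<j$, covering $[2n]$. It avoids $\tau\in S_k$ if there are no $i_1<\dots<i_{2k}$ such that all pairs $(i_a,i_{2k+1-\tau(a)})$, $1\le a\le k$, belong to it. $\mathcal{M}_n(213,321)$ is the set of perfect matchings of $[2n]$ avoiding both $213$ and $321$. -}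

module Defs where

open import Data.Nat using (ℕ; zero; suc; _+_; _*_; _≤_)
open import Data.Integer using (ℤ; +_; 0ℤ; 1ℤ) renaming (_+_ to _+ℤ_; _-_ to _-ℤ_)
open import Data.Fin using (Fin; zero; suc; _<_; _↑ˡ_; _↑ʳ_; opposite)
open import Data.Vec using (Vec; lookup; []; _∷_)
open import Data.List using (List; length)
open import Data.List.Relation.Unary.Unique.Propositional using (Unique)
open import Data.List.Membership.Propositional using (_∈_)
open import Data.Product using (Σ; ∃; _×_; _,_)
open import Relation.Binary.PropositionalEquality using (_≡_; _≢_)
open import Relation.Nullary using (¬_)
open import Function.Bundles using (_⇔_)

-- A perfect matching of a finite set of size m (positions Fin m, i.e. the
-- elements 1..m shifted to 0..m-1) is encoded as a fixed-point-free
-- involution v : the pairs of the matching are exactly {x , lookup v x}.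
IsPerfectMatching : ∀ {m} → Vec (Fin m) m → Set
IsPerfectMatching v = ∀ x → (lookup v (lookup v x) ≡ x) × (lookup v x ≢ x)

-- An occurrence of the pattern τ ∈ S_k (one-line notation, 0-indexed values)
-- in the matching v: indices i_1 < ... < i_{2k} (here ι 0 < ... < ι (2k-1))
-- such that every pair (i_a , i_{2k+1-τ(a)}) belongs to the matching.
-- 0-indexed: a ↦ position a, partner position k + (k-1-τ(a)).
Occurs : ∀ {k m} → Vec (Fin k) k → Vec (Fin m) m → Set
Occurs {k} {m} τ v =
  Σ (Fin (k + k) → Fin m) λ ι →
    (∀ a b → a < b → ι a < ι b) ×
    (∀ (a : Fin k) → lookup v (ι (a ↑ˡ k)) ≡ ι (k ↑ʳ opposite (lookup τ a)))

Avoids : ∀ {k m} → Vec (Fin k) k → Vec (Fin m) m → Set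
Avoids τ v = ¬ Occurs τ v

p213 : Vec (Fin 3) 3
p213 = suc zero ∷ zero ∷ suc (suc zero) ∷ []

p321 : Vec (Fin 3) 3
p321 = suc (suc zero) ∷ suc zero ∷ zero ∷ []

InM : (n : ℕ) → Vec (Fin (2 * n)) (2 * n) → Set
InM n v = IsPerfectMatching v × Avoids p213 v × Avoids p321 v

HasCard : {A : Set} → (A → Set) → ℕ → Set
HasCard {A} P N =
  Σ (List A) λ xs → Unique xs × (∀ a → (a ∈ xs) ⇔ P a) × (length xs ≡ N)

-- coefficient of t^i u^j
Poly2 : Set
Poly2 = ℕ → ℕ → ℤ

IsPoly : Poly2 → Set
IsPoly p = ∃ λ B → ∀ i j → B ≤ i + j → p i j ≡ 0ℤ

-- coefficient of z^m
Series : Set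
Series = ℕ → Poly2

IsPolySeries : Series → Set
IsPolySeries G = ∀ m → IsPoly (G m)

oneP : Poly2
oneP zero zero = 1ℤ
oneP _    _    = 0ℤ

infixl 6 _⊕_ _⊖_ _⊕ₛ_

_⊕_ : Poly2 → Poly2 → Poly2
(p ⊕ q) i j = p i j +ℤ q i j

_⊖_ : Poly2 → Poly2 → Poly2
(p ⊖ q) i j = p i j -ℤ q i j

mulT : Poly2 → Poly2
mulT p zero    j = 0ℤ
mulT p (suc i) j = p i j

mulU : Poly2 → Poly2
mulU p i zero    = 0ℤ
mulU p i (suc j) = p i j

mul1-u : Poly2 → Poly2
mul1-u p = p ⊖ mulU p

atU0 : Poly2 → Poly2
atU0 p i zero    = p i 0
atU0 p i (suc j) = 0ℤ

at00 : Poly2 → Poly2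
at00 p zero zero = p 0 0
at00 p _    _    = 0ℤ

-- q(tu) for a univariate q (coefficient list ℕ → ℤ)
diag : (ℕ → ℤ) → Poly2
diag q zero    zero    = q 0
diag q (suc i) (suc j) = diag (λ l → q (suc l)) i j
diag q zero    (suc j) = 0ℤ
diag q (suc i) zero    = 0ℤ

atTU0 : Poly2 → Poly2
atTU0 p = diag (λ i → p i 0)

_⊕ₛ_ : Series → Series → Series
(F ⊕ₛ H) m = F m ⊕ H m

mulZ : Series → Series
mulZ F zero    = λ _ _ → 0ℤ
mulZ F (suc m) = F m

oneS : Series
oneS zero    = oneP
oneS (suc m) = λ _ _ → 0ℤ

liftS : (Poly2 → Poly2) → Series → Series
liftS f F m = f (F m)

_≈ₛ_ : Series → Series → Set
F ≈ₛ H = ∀ m i j → F m i j ≡ H m i j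

mulTU1-u : Poly2 → Poly2
mulTU1-u p = mulT (mulU (mul1-u p))

-- The functional equation
--   G = 1 + z ( t G + (G - G(t,0))/(tu) + (G(t,0) - G(0,0))/t
--               + tu/(1-u) (G(t,0) - G(tu,0)) )
-- multiplied through by t u (1 - u):
--   tu(1-u) G = tu(1-u) + z ( t^2 u (1-u) G + (1-u)(G - G(t,0))
--               + u(1-u)(G(t,0) - G(0,0)) + t^2 u^2 (G(t,0) - G(tu,0)) )
FunEq : Series → Set
FunEq G =
  liftS mulTU1-u G ≈ₛ
  (liftS mulTU1-u oneS ⊕ₛ mulZ (λ m →
       mulT (mulT (mulU (mul1-u (G m))))
     ⊕ mul1-u (G m ⊖ atU0 (G m))
     ⊕ mulU (mul1-u (atU0 (G m) ⊖ at00 (G m)))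
     ⊕ mulT (mulT (mulU (mulU (atU0 (G m) ⊖ atTU0 (G m)))))))

{-# OPTIONS --safe #-}

-- Scan the matching from left to right and record the open arcs in the order in
-- which they will close, as a word in their openers. Avoiding 213 and 321 means
-- that this word never contains 312 or 123. A new opener is the maximum of the
-- word, so the word must be decreasing before it and decreasing after it: into a
-- decreasing word of length a it can be inserted at any of a + 1 places, and into
-- a word with an ascent only at that (unique) ascent, which stays where it is.
-- Closing an arc removes the first letter. Hence the word matters only through
-- its length a and the position b of its ascent (0 if there is none), and
-- matchings are counted by walks on such pairs from (0 , 0) to (0 , 0). The
-- functional equation is the recursion for the walks from (0 , 0) to (a , b), with
-- weight t^a u^b, which also determines G uniquely.
--
-- For the bijection the walk is read backwards: deleting the first point of a
-- partial matching on the last r points turns its partner into a pending closer,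
-- encoded as a fixed point of the involution.
module Submission where

open import Defs
open import Algebra.Properties.AbelianGroup using (∙-cancelʳ)
open import Data.Bool using (Bool; true; false; _∧_; T)
open import Data.Bool.Properties using (∧-zeroʳ; ∧-identityʳ)
open import Data.Empty using (⊥; ⊥-elim)
open import Data.Fin as Fin using (Fin; zero; suc; toℕ; inject₁)
import Data.Fin.Properties as Fin
open import Data.Integer as ℤ using (ℤ; +_; 0ℤ; 1ℤ) renaming (_+_ to _+ℤ_; _-_ to _-ℤ_)
import Data.Integer.Properties as ℤ
open import Data.Integer.Tactic.RingSolver using (solve-∀)
open import Data.List using (List; []; _∷_; [_]; _++_; map; length; downFrom; concatMap)
open import Data.List.Membership.Propositional using (_∈_)
open import Data.List.Membership.Propositional.Properties using (∈-++⁺ˡ; ∈-++⁺ʳ; ∈-++⁻; ∈-map⁻)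
open import Data.List.Properties using (map-++; length-++; length-map)
open import Data.List.Relation.Unary.All as All using (All; []; _∷_)
open import Data.List.Relation.Unary.AllPairs using ([]; _∷_)
open import Data.List.Relation.Unary.Any using (here)
open import Data.List.Relation.Unary.Unique.Propositional using (Unique)
open import Data.List.Relation.Unary.Unique.Propositional.Properties using (++⁺; map⁻)
open import Data.Nat as ℕ using (ℕ; zero; suc; pred; _+_; _*_; _≤_; _<_; z≤n; s≤s; _≡ᵇ_; _≤?_)
import Data.Nat.Properties as ℕ
open import Data.Nat.ListAction using (sum)
open import Data.Nat.ListAction.Properties using (sum-++)
open import Data.Product using (Σ; _×_; _,_; ∃-syntax; proj₁; proj₂)
open import Data.Sum using (_⊎_; inj₁; inj₂; [_,_]′)
open import Data.Unit using (⊤; tt)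
open import Data.Vec as Vec using (Vec; []; _∷_; lookup; tabulate; _[_]≔_)
open import Data.Vec.Properties using (lookup∘tabulate; tabulate∘lookup; tabulate-cong; lookup-map; lookup∘update; lookup∘update′)
open import Function.Bundles using (_⇔_; mk⇔; Equivalence)
open import Relation.Binary using (tri<; tri≈; tri>)
open import Relation.Binary.PropositionalEquality using (_≡_; _≢_; refl; sym; trans; cong; cong₂; subst; subst₂; module ≡-Reasoning)
open import Relation.Nullary using (¬_; yes; no; contradiction; does)
open import Relation.Nullary.Decidable using (dec-true; dec-false)

-- The functional equation and its unique solution

infix 4 _≗₂_
_≗₂_ : Poly2 → Poly2 → Set
p ≗₂ q = ∀ i j → p i j ≡ q i j

-- The coefficient of u^j in x (1 - u^i) / (1 - u): it is `x` when `j < i` and zero otherwise.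
below : ℕ → ℕ → ℤ → ℤ
below j       zero    x = 0ℤ
below zero    (suc i) x = x
below (suc j) (suc i) x = below j i x

shiftTU : Poly2 → Poly2
shiftTU p i j = p (suc i) (suc j)

shiftT₀ : Poly2 → Poly2
shiftT₀ p i zero    = p (suc i) 0
shiftT₀ p i (suc j) = 0ℤ

-- A term x t^i of G(t,0) contributes x t^(i+1) (u + ... + u^i) to tu (G(t,0) - G(tu,0)) / (1 - u).
newCut : Poly2 → Poly2
newCut p zero    j       = 0ℤ
newCut p (suc i) zero    = 0ℤ
newCut p (suc i) (suc j) = below j i (p i 0)

-- One application of the bracket of the functional equation: the four summands
-- are its four terms, with the divisions by tu, t and 1 - u carried out.
Step : Poly2 → Poly2
Step p = mulT p ⊕ shiftTU p ⊕ shiftT₀ p ⊕ newCut p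

-- The same bracket multiplied by t u (1 - u), as it occurs in FunEq.
RHS : Poly2 → Poly2
RHS p = mulT (mulT (mulU (mul1-u p)))
      ⊕ mul1-u (p ⊖ atU0 p)
      ⊕ mulU (mul1-u (atU0 p ⊖ at00 p))
      ⊕ mulT (mulT (mulU (mulU (atU0 p ⊖ atTU0 p))))

-- With `below-suc`, this is (1 - u)(1 + ... + u^(i-1)) = 1 - u^i read off coefficientwise; `diag`
-- supplies the u^i.
below-zero : ∀ q i → below 0 i (q i) ≡ q i -ℤ diag q i 0
below-zero q zero    = sym (ℤ.+-inverseʳ (q 0))
below-zero q (suc i) = sym (ℤ.+-identityʳ (q (suc i)))

below-suc : ∀ q i j → below (suc j) i (q i) ≡ below j i (q i) -ℤ diag q i (suc j)
below-suc q zero    j       = refl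
below-suc q (suc i) zero    = below-zero (λ l → q (suc l)) i
below-suc q (suc i) (suc j) = below-suc (λ l → q (suc l)) i j

-- `RHS` carries an extra factor tu, hence the shift of both indices. The cases are split until the
-- shifts compute; a linear identity in the coefficients remains.
mul1-u-Step : ∀ p i j → mul1-u (Step p) i j ≡ RHS p (suc i) (suc j)
mul1-u-Step p zero zero = lem (p 1 1) (p 1 0)
  where lem : ∀ x y → (((0ℤ +ℤ x) +ℤ y) +ℤ 0ℤ) -ℤ 0ℤ ≡ ((0ℤ +ℤ ((x -ℤ 0ℤ) -ℤ (y -ℤ y))) +ℤ ((y -ℤ 0ℤ) -ℤ 0ℤ)) +ℤ 0ℤ
        lem = solve-∀
mul1-u-Step p zero (suc zero) = lem (p 1 2) (p 1 1) (p 1 0)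
  where lem : ∀ x y z → (((0ℤ +ℤ x) +ℤ 0ℤ) +ℤ 0ℤ) -ℤ (((0ℤ +ℤ y) +ℤ z) +ℤ 0ℤ)
                  ≡ ((0ℤ +ℤ ((x -ℤ 0ℤ) -ℤ (y -ℤ 0ℤ))) +ℤ ((0ℤ -ℤ 0ℤ) -ℤ (z -ℤ 0ℤ))) +ℤ 0ℤ
        lem = solve-∀
mul1-u-Step p zero (suc (suc j)) = lem (p 1 (3 + j)) (p 1 (2 + j))
  where lem : ∀ x y → (((0ℤ +ℤ x) +ℤ 0ℤ) +ℤ 0ℤ) -ℤ (((0ℤ +ℤ y) +ℤ 0ℤ) +ℤ 0ℤ)
                  ≡ ((0ℤ +ℤ ((x -ℤ 0ℤ) -ℤ (y -ℤ 0ℤ))) +ℤ ((0ℤ -ℤ 0ℤ) -ℤ (0ℤ -ℤ 0ℤ))) +ℤ 0ℤ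
        lem = solve-∀
mul1-u-Step p (suc i) zero = lem (p i 0) (p (2 + i) 1) (p (2 + i) 0)
  where lem : ∀ w x y → (((w +ℤ x) +ℤ y) +ℤ 0ℤ) -ℤ 0ℤ ≡ (((w -ℤ 0ℤ) +ℤ ((x -ℤ 0ℤ) -ℤ (y -ℤ y))) +ℤ ((y -ℤ 0ℤ) -ℤ 0ℤ)) +ℤ 0ℤ
        lem = solve-∀
mul1-u-Step p (suc i) (suc zero)
  rewrite below-zero (λ l → p l 0) i = lem (p i 1) (p i 0) (p (2 + i) 2) (p (2 + i) 1) (p (2 + i) 0) (p i 0 -ℤ diag (λ l → p l 0) i 0)
  where lem : ∀ w v x y z d → (((w +ℤ x) +ℤ 0ℤ) +ℤ d) -ℤ (((v +ℤ y) +ℤ z) +ℤ 0ℤ)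
                  ≡ (((w -ℤ v) +ℤ ((x -ℤ 0ℤ) -ℤ (y -ℤ 0ℤ))) +ℤ ((0ℤ -ℤ 0ℤ) -ℤ (z -ℤ 0ℤ))) +ℤ d
        lem = solve-∀
mul1-u-Step p (suc i) (suc (suc j))
  rewrite below-suc (λ l → p l 0) i j = lem (p i (2 + j)) (p i (1 + j)) (p (2 + i) (3 + j)) (p (2 + i) (2 + j)) (below j i (p i 0)) (diag (λ l → p l 0) i (suc j))
  where lem : ∀ w v x y b d → (((w +ℤ x) +ℤ 0ℤ) +ℤ (b -ℤ d)) -ℤ (((v +ℤ y) +ℤ 0ℤ) +ℤ b)
                  ≡ (((w -ℤ v) +ℤ ((x -ℤ 0ℤ) -ℤ (y -ℤ 0ℤ))) +ℤ ((0ℤ -ℤ 0ℤ) -ℤ (0ℤ -ℤ 0ℤ))) +ℤ (0ℤ -ℤ d)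
        lem = solve-∀

mul1-u-0 : mul1-u (λ _ _ → 0ℤ) ≗₂ (λ _ _ → 0ℤ)
mul1-u-0 i zero    = refl
mul1-u-0 i (suc j) = refl

-- Since 1 - u has constant term 1, the coefficients of u^0, u^1, ... are recovered one after
-- another.
mul1-u-injective : ∀ p q → mul1-u p ≗₂ mul1-u q → p ≗₂ q
mul1-u-injective p q eq i zero = begin
  p i 0        ≡⟨ ℤ.+-identityʳ _ ⟨
  p i 0 -ℤ 0ℤ  ≡⟨ eq i 0 ⟩
  q i 0 -ℤ 0ℤ  ≡⟨ ℤ.+-identityʳ _ ⟩
  q i 0        ∎
  where open ≡-Reasoning
mul1-u-injective p q eq i (suc j) =
  ∙-cancelʳ ℤ.+-0-abelianGroup (ℤ.- p i j) _ _
    (trans (eq i (suc j)) (cong (q i (suc j) -ℤ_) (sym (mul1-u-injective p q eq i j))))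

Step-cong : ∀ {p q} → p ≗₂ q → Step p ≗₂ Step q
Step-cong {p} {q} e i j =
  cong₂ _+ℤ_ (cong₂ _+ℤ_ (cong₂ _+ℤ_ (e₁ i j) (e (suc i) (suc j))) (e₃ i j)) (e₄ i j)
  where
  e₁ : mulT p ≗₂ mulT q
  e₁ zero    j = refl
  e₁ (suc i) j = e i j
  e₃ : shiftT₀ p ≗₂ shiftT₀ q
  e₃ i zero    = e (suc i) 0
  e₃ i (suc j) = refl
  e₄ : newCut p ≗₂ newCut q
  e₄ zero    j       = refl
  e₄ (suc i) zero    = refl
  e₄ (suc i) (suc j) = cong (below j i) (e i 0)

iterStep : ℕ → Poly2 → Poly2
iterStep zero    p = p
iterStep (suc m) p = Step (iterStep m p)

iterStep-Step : ∀ m p → iterStep m (Step p) ≡ Step (iterStep m p)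
iterStep-Step zero    p = refl
iterStep-Step (suc m) p = cong Step (iterStep-Step m p)

walks : Series
walks m = iterStep m oneP

-- Read at `suc i`, `suc j`, the equation loses its factor tu, and cancelling 1 - u then gives the
-- coefficient of z^(m+1) as `Step` of that of z^m.
FunEq⇒walks : ∀ G → FunEq G → ∀ m → G m ≗₂ walks m
FunEq⇒walks G eq zero = mul1-u-injective (G 0) oneP λ i j →
  trans (eq 0 (suc i) (suc j)) (ℤ.+-identityʳ _)
FunEq⇒walks G eq (suc m) i j = trans
  (mul1-u-injective (G (suc m)) (Step (G m)) step i j)
  (Step-cong (FunEq⇒walks G eq m) i j)
  where
  step : mul1-u (G (suc m)) ≗₂ mul1-u (Step (G m))
  step i j = begin
    mul1-u (G (suc m)) i j                                   ≡⟨ eq (suc m) (suc i) (suc j) ⟩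
    mul1-u (λ _ _ → 0ℤ) i j +ℤ RHS (G m) (suc i) (suc j)     ≡⟨ cong (_+ℤ RHS (G m) (suc i) (suc j)) (mul1-u-0 i j) ⟩
    0ℤ +ℤ RHS (G m) (suc i) (suc j)                          ≡⟨ ℤ.+-identityˡ _ ⟩
    RHS (G m) (suc i) (suc j)                                ≡⟨ mul1-u-Step (G m) i j ⟨
    mul1-u (Step (G m)) i j                                  ∎
    where open ≡-Reasoning

below-≡0 : ∀ j i {x} → (j < i → x ≡ 0ℤ) → below j i x ≡ 0ℤ
below-≡0 j       zero    h = refl
below-≡0 zero    (suc i) h = h (s≤s z≤n)
below-≡0 (suc j) (suc i) h = below-≡0 j i (λ j<i → h (s≤s j<i))

+-zeros : ∀ {a b c d} → a ≡ 0ℤ → b ≡ 0ℤ → c ≡ 0ℤ → d ≡ 0ℤ → a +ℤ b +ℤ c +ℤ d ≡ 0ℤ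
+-zeros refl refl refl refl = refl

-- This makes G - G(t,0) vanish at t = 0, so that its division by tu is exact, as `walks-FunEq`
-- requires. No term of the bracket produces a u-exponent above the t-exponent from coefficients
-- without one.
walks-triangular : ∀ m i j → i < j → walks m i j ≡ 0ℤ
walks-triangular zero    zero    (suc j) _ = refl
walks-triangular zero    (suc i) (suc j) _ = refl
walks-triangular (suc m) i (suc j) i<j = +-zeros (c₁ i i<j) (walks-triangular m (suc i) (2 + j) (s≤s i<j)) refl (c₄ i i<j)
  where
  c₁ : ∀ i → i < suc j → mulT (walks m) i (suc j) ≡ 0ℤ
  c₁ zero    _   = refl
  c₁ (suc i) i<j = walks-triangular m i (suc j) (ℕ.<-trans (ℕ.n<1+n i) i<j)
  c₄ : ∀ i → i < suc j → newCut (walks m) i (suc j) ≡ 0ℤ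
  c₄ zero    _         = refl
  c₄ (suc i) (s≤s i<j) = below-≡0 j i (λ j<i → contradiction j<i (ℕ.<-asym i<j))

walks-IsPoly : IsPolySeries walks
walks-IsPoly m = degreeBound m , bounded m
  where
  degreeBound : ℕ → ℕ
  degreeBound zero    = 1
  -- The doubling is due to `newCut`, which turns t^i into terms of degree up to 2i + 1.
  degreeBound (suc m) = 2 + (degreeBound m + degreeBound m)
  weaken : ∀ B {n} → 2 + (B + B) ≤ n → 2 + B ≤ n
  weaken B = ℕ.≤-trans (s≤s (s≤s (ℕ.m≤m+n B B)))
  bounded : ∀ m i j → degreeBound m ≤ i + j → walks m i j ≡ 0ℤ
  bounded zero    zero    (suc j) _ = refl
  bounded zero    (suc i) j       _ = refl
  bounded (suc m) i j le = +-zeros (c₁ i le) (bounded m (suc i) (suc j) le₂) (c₃ j le) (c₄ i j le)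
    where
    B = degreeBound m
    le₂ : B ≤ suc i + suc j
    le₂ = begin
      B            ≤⟨ ℕ.m≤n+m B 2 ⟩
      2 + B        ≤⟨ weaken B le ⟩
      i + j        ≤⟨ ℕ.+-mono-≤ (ℕ.n≤1+n i) (ℕ.n≤1+n j) ⟩
      suc i + suc j ∎
      where open ℕ.≤-Reasoning
    c₁ : ∀ i → 2 + (B + B) ≤ i + j → mulT (walks m) i j ≡ 0ℤ
    c₁ zero    _  = refl
    c₁ (suc i) le = bounded m i j (ℕ.≤-trans (ℕ.n≤1+n B) (ℕ.≤-pred (weaken B le)))
    c₃ : ∀ j → 2 + (B + B) ≤ i + j → shiftT₀ (walks m) i j ≡ 0ℤ
    c₃ zero    le = bounded m (suc i) 0 (ℕ.≤-trans (ℕ.m≤n+m B 2) (ℕ.≤-trans (weaken B le) (ℕ.n≤1+n _)))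
    c₃ (suc j) _  = refl
    c₄ : ∀ i j → 2 + (B + B) ≤ i + j → newCut (walks m) i j ≡ 0ℤ
    c₄ zero    j       _  = refl
    c₄ (suc i) zero    _  = refl
    c₄ (suc i) (suc j) le = below-≡0 j i λ j<i → bounded m i 0 (subst (B ≤_) (sym (ℕ.+-identityʳ i)) (large j<i))
      where
      large : j < i → B ≤ i
      large j<i with B ≤? i
      ... | yes B≤i = B≤i
      ... | no  B≰i = contradiction (ℕ.≤-trans le (ℕ.+-mono-≤ i<B (ℕ.<-trans j<i i<B))) (ℕ.<⇒≱ (ℕ.m≤n+m _ 1))
        where i<B = ℕ.≰⇒> B≰i

walks-FunEq : FunEq walks
walks-FunEq zero    i j = sym (ℤ.+-identityʳ _)
-- In the row t^0, and in the column u^0 treated next, the side multiplied by tu is zero, so `RHS`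
-- has to vanish; in the row this rests on triangularity.
walks-FunEq (suc m) zero j = trans (sym (vanish j)) (sym (ℤ.+-identityˡ _))
  where
  p = walks m
  tri : ∀ j → p 0 (suc j) ≡ 0ℤ
  tri j = walks-triangular m 0 (suc j) (s≤s z≤n)
  diff₀ : ∀ j → (p ⊖ atU0 p) 0 j ≡ 0ℤ
  diff₀ zero    = ℤ.+-inverseʳ (p 0 0)
  diff₀ (suc j) = trans (ℤ.+-identityʳ _) (tri j)
  diff₀₀ : ∀ j → (atU0 p ⊖ at00 p) 0 j ≡ 0ℤ
  diff₀₀ zero    = ℤ.+-inverseʳ (p 0 0)
  diff₀₀ (suc j) = refl
  mul1-u-row : ∀ q → (∀ j → q 0 j ≡ 0ℤ) → ∀ j → mul1-u q 0 j ≡ 0ℤ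
  mul1-u-row q h zero    = cong (_-ℤ 0ℤ) (h 0)
  mul1-u-row q h (suc j) = cong₂ _-ℤ_ (h (suc j)) (h j)
  mulU-row : ∀ q → (∀ j → q 0 j ≡ 0ℤ) → ∀ j → mulU q 0 j ≡ 0ℤ
  mulU-row q h zero    = refl
  mulU-row q h (suc j) = h j
  vanish : ∀ j → RHS p 0 j ≡ 0ℤ
  vanish j = +-zeros refl (mul1-u-row (p ⊖ atU0 p) diff₀ j)
    (mulU-row (mul1-u (atU0 p ⊖ at00 p)) (mul1-u-row (atU0 p ⊖ at00 p) diff₀₀) j) refl
walks-FunEq (suc m) (suc i) zero = trans (sym (vanish i)) (sym (ℤ.+-identityˡ _))
  where
  p = walks m
  mulTU-column : ∀ q i → mulT (mulU q) i 0 ≡ 0ℤ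
  mulTU-column q zero    = refl
  mulTU-column q (suc i) = refl
  vanish : ∀ i → RHS p (suc i) 0 ≡ 0ℤ
  vanish i = +-zeros (mulTU-column (mul1-u p) i)
    (cong (_-ℤ 0ℤ) (ℤ.+-inverseʳ (p (suc i) 0))) refl
    (mulTU-column (mulU (atU0 p ⊖ atTU0 p)) i)
walks-FunEq (suc m) (suc i) (suc j) = trans (mul1-u-Step (walks m) i j)
  (sym (trans (cong (_+ℤ RHS (walks m) (suc i) (suc j)) (mul1-u-0 i j)) (ℤ.+-identityˡ _)))

-- Parity of the walks

Odd : ℕ → Set
Odd zero          = ⊥
Odd (suc zero)    = ⊤
Odd (suc (suc n)) = Odd n

Odd-suc-2* : ∀ n → Odd (suc (2 * n))
Odd-suc-2* zero    = tt
Odd-suc-2* (suc n) = subst Odd (cong suc (sym (ℕ.*-suc 2 n))) (Odd-suc-2* n)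

-- Each term of the bracket changes the t-exponent by exactly one.
walks-parity : ∀ m i j → Odd (i + m) → walks m i j ≡ 0ℤ
walks-parity zero    (suc i) j _ = refl
walks-parity (suc m) i j o = +-zeros (c₁ i o) (up j) (c₃ j) (c₄ i j o)
  where
  down : ∀ i j → Odd (suc i + suc m) → walks m i j ≡ 0ℤ
  down i j o = walks-parity m i j (subst (λ n → Odd (suc n)) (ℕ.+-suc i m) o)
  up : ∀ j → walks m (suc i) (suc j) ≡ 0ℤ
  up j = walks-parity m (suc i) (suc j) (subst Odd (ℕ.+-suc i m) o)
  c₁ : ∀ i → Odd (i + suc m) → mulT (walks m) i j ≡ 0ℤ
  c₁ zero    _ = refl
  c₁ (suc i) o = down i j o
  c₃ : ∀ j → shiftT₀ (walks m) i j ≡ 0ℤ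
  c₃ zero    = walks-parity m (suc i) 0 (subst Odd (ℕ.+-suc i m) o)
  c₃ (suc j) = refl
  c₄ : ∀ i j → Odd (i + suc m) → newCut (walks m) i j ≡ 0ℤ
  c₄ zero    j       _ = refl
  c₄ (suc i) zero    _ = refl
  c₄ (suc i) (suc j) o = below-≡0 j i (λ _ → down i 0 o)

-- Walks on states and the iterates of the bracket

-- (a , b): a pending arcs; b is the rank of the unique ascent in their closing
-- order, and 0 if that order is decreasing.
State : Set
State = ℕ × ℕ

-- If b is 1, closing removes the only letter before the ascent and the word becomes decreasing,
-- which `pred` codes correctly as 0. In `openings (a , zero)` the new second component is the
-- number of letters before the inserted maximum; with none, no ascent arises.
closings openings successors : State → List State
closings (zero  , b) = []
closings (suc a , b) = [ a , pred b ]
openings (a , zero)  = map (suc a ,_) (downFrom (suc a))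
openings (a , suc b) = [ suc a , suc b ]
successors s = openings s ++ closings s

excursions : ℕ → State → ℕ
excursions zero    (zero  , zero)  = 1
excursions zero    (zero  , suc b) = 0
excursions zero    (suc a , b)     = 0
excursions (suc r) s = sum (map (excursions r) (successors s))

indicator : Bool → ℤ
indicator false = 0ℤ
indicator true  = 1ℤ

monomial : State → Poly2
monomial (a , b) i j = indicator ((a ≡ᵇ i) ∧ (b ≡ᵇ j))

monomials : List State → Poly2
monomials []      = λ _ _ → 0ℤ
monomials (s ∷ L) = monomial s ⊕ monomials L

monomials-++ : ∀ K L → monomials (K ++ L) ≗₂ (monomials K ⊕ monomials L)
monomials-++ []      L i j = sym (ℤ.+-identityˡ _)
monomials-++ (s ∷ K) L i j = trans (cong (monomial s i j +ℤ_) (monomials-++ K L i j)) (sym (ℤ.+-assoc (monomial s i j) _ _))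

below-+ : ∀ j i x y → below j i (x +ℤ y) ≡ below j i x +ℤ below j i y
below-+ j       zero    x y = refl
below-+ zero    (suc i) x y = refl
below-+ (suc j) (suc i) x y = below-+ j i x y

Step-⊕ : ∀ p q → Step (p ⊕ q) ≗₂ (Step p ⊕ Step q)
Step-⊕ p q i j = trans
  (cong₂ _+ℤ_ (cong₂ _+ℤ_ (cong₂ _+ℤ_ (e₁ i j) refl) (e₃ i j)) (e₄ i j))
  (interchange (mulT p i j) (shiftTU p i j) (shiftT₀ p i j) (newCut p i j)
               (mulT q i j) (shiftTU q i j) (shiftT₀ q i j) (newCut q i j))
  where
  e₁ : mulT (p ⊕ q) ≗₂ (mulT p ⊕ mulT q)
  e₁ zero    j = refl
  e₁ (suc i) j = refl
  e₃ : shiftT₀ (p ⊕ q) ≗₂ (shiftT₀ p ⊕ shiftT₀ q)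
  e₃ i zero    = refl
  e₃ i (suc j) = refl
  e₄ : newCut (p ⊕ q) ≗₂ (newCut p ⊕ newCut q)
  e₄ zero    j       = refl
  e₄ (suc i) zero    = refl
  e₄ (suc i) (suc j) = below-+ j i (p i 0) (q i 0)
  interchange : ∀ a b c d a' b' c' d' →
    (((a +ℤ a') +ℤ (b +ℤ b')) +ℤ (c +ℤ c')) +ℤ (d +ℤ d') ≡ (((a +ℤ b) +ℤ c) +ℤ d) +ℤ (((a' +ℤ b') +ℤ c') +ℤ d')
  interchange = solve-∀

Step-0 : Step (λ _ _ → 0ℤ) ≗₂ (λ _ _ → 0ℤ)
Step-0 i j = +-zeros (c₁ i) refl (c₃ j) (c₄ i j)
  where
  c₁ : ∀ i → mulT (λ _ _ → 0ℤ) i j ≡ 0ℤ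
  c₁ zero    = refl
  c₁ (suc i) = refl
  c₃ : ∀ j → shiftT₀ (λ _ _ → 0ℤ) i j ≡ 0ℤ
  c₃ zero    = refl
  c₃ (suc j) = refl
  c₄ : ∀ i j → newCut (λ _ _ → 0ℤ) i j ≡ 0ℤ
  c₄ zero    j       = refl
  c₄ (suc i) zero    = refl
  c₄ (suc i) (suc j) = below-≡0 j i (λ _ → refl)

indicator-false : ∀ x → indicator (x ∧ false) ≡ 0ℤ
indicator-false x = cong indicator (∧-zeroʳ x)

below-step : ∀ x k j → indicator (x ∧ (k ≡ᵇ j)) +ℤ below j k (indicator x) ≡ below j (suc k) (indicator x)
below-step x zero    zero    = trans (ℤ.+-identityʳ _) (cong indicator (∧-identityʳ x))
below-step x (suc k) zero    = trans (cong (_+ℤ indicator x) (indicator-false x)) (ℤ.+-identityˡ _)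
below-step x zero    (suc j) = trans (ℤ.+-identityʳ _) (indicator-false x)
below-step x (suc k) (suc j) = below-step x k j

monomials-row : ∀ a k i j → monomials (map (suc a ,_) (downFrom k)) (suc i) j ≡ below j k (indicator (a ≡ᵇ i))
monomials-row a zero    i j = refl
monomials-row a (suc k) i j =
  trans (cong (monomial (suc a , k) (suc i) j +ℤ_) (monomials-row a k i j)) (below-step (a ≡ᵇ i) k j)

monomials-row₀ : ∀ a k j → monomials (map (suc a ,_) (downFrom k)) 0 j ≡ 0ℤ
monomials-row₀ a zero    j = refl
monomials-row₀ a (suc k) j = trans (ℤ.+-identityˡ _) (monomials-row₀ a k j)

below-indicator : ∀ j a i → below j a (indicator (a ≡ᵇ i)) ≡ below j i (indicator (a ≡ᵇ i))
below-indicator j a i with a ≡ᵇ i in eq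
... | true  = cong (λ n → below j n 1ℤ) (ℕ.≡ᵇ⇒≡ a i (subst T (sym eq) tt))
... | false = trans (below-≡0 j a (λ _ → refl)) (sym (below-≡0 j i (λ _ → refl)))

-- For cut 0, `mulT` is the insertion in front and `newCut` the a insertions that create an ascent.
-- For a positive cut only `mulT` contributes, because `newCut` reads the coefficients of u^0.
monomials-openings : ∀ s → monomials (openings s) ≗₂ (mulT (monomial s) ⊕ newCut (monomial s))
monomials-openings (a , zero) zero    j = monomials-row₀ a (suc a) j
monomials-openings (a , zero) (suc i) zero = trans (monomials-row a (suc a) i 0)
  (sym (trans (ℤ.+-identityʳ _) (cong indicator (∧-identityʳ (a ≡ᵇ i)))))
monomials-openings (a , zero) (suc i) (suc j) = begin
  monomials (openings (a , 0)) (suc i) (suc j)          ≡⟨ monomials-row a (suc a) i (suc j) ⟩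
  below j a (indicator (a ≡ᵇ i))                        ≡⟨ below-indicator j a i ⟩
  below j i (indicator (a ≡ᵇ i))                        ≡⟨ cong (λ b → below j i (indicator b)) (∧-identityʳ (a ≡ᵇ i)) ⟨
  newCut (monomial (a , 0)) (suc i) (suc j)             ≡⟨ ℤ.+-identityˡ _ ⟨
  0ℤ +ℤ newCut (monomial (a , 0)) (suc i) (suc j)       ≡⟨ cong (_+ℤ newCut (monomial (a , 0)) (suc i) (suc j)) (indicator-false (a ≡ᵇ i)) ⟨
  (mulT (monomial (a , 0)) ⊕ newCut (monomial (a , 0))) (suc i) (suc j) ∎
  where open ≡-Reasoning
monomials-openings (a , suc b) zero    j = refl
monomials-openings (a , suc b) (suc i) zero = refl
monomials-openings (a , suc b) (suc i) (suc j) = cong (monomial (a , suc b) i (suc j) +ℤ_)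
  (sym (below-≡0 j i (λ _ → indicator-false (a ≡ᵇ i))))

monomials-closings : ∀ s → monomials (closings s) ≗₂ (shiftTU (monomial s) ⊕ shiftT₀ (monomial s))
monomials-closings (zero  , b) i zero    = refl
monomials-closings (zero  , b) i (suc j) = refl
monomials-closings (suc a , zero) i zero = trans (ℤ.+-identityʳ (monomial (a , 0) i 0))
  (sym (trans (cong (_+ℤ monomial (a , 0) i 0) (indicator-false (a ≡ᵇ i))) (ℤ.+-identityˡ (monomial (a , 0) i 0))))
monomials-closings (suc a , zero) i (suc j) = refl
monomials-closings (suc a , suc b) i zero    = cong (monomial (a , b) i 0 +ℤ_) (sym (indicator-false (a ≡ᵇ i)))
monomials-closings (suc a , suc b) i (suc j) = refl

Step-monomial : ∀ s → Step (monomial s) ≗₂ monomials (successors s)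
Step-monomial s i j = sym (begin
  monomials (openings s ++ closings s) i j                          ≡⟨ monomials-++ (openings s) (closings s) i j ⟩
  monomials (openings s) i j +ℤ monomials (closings s) i j          ≡⟨ cong₂ _+ℤ_ (monomials-openings s i j) (monomials-closings s i j) ⟩
  (mulT p i j +ℤ newCut p i j) +ℤ (shiftTU p i j +ℤ shiftT₀ p i j)  ≡⟨ reorder (mulT p i j) (newCut p i j) (shiftTU p i j) (shiftT₀ p i j) ⟩
  Step p i j                                                        ∎)
  where
  open ≡-Reasoning
  p = monomial s
  reorder : ∀ a d b c → (a +ℤ d) +ℤ (b +ℤ c) ≡ ((a +ℤ b) +ℤ c) +ℤ d
  reorder = solve-∀

Step-monomials : ∀ L → Step (monomials L) ≗₂ monomials (concatMap successors L)
Step-monomials []      i j = Step-0 i j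
Step-monomials (s ∷ L) i j = begin
  Step (monomial s ⊕ monomials L) i j                                  ≡⟨ Step-⊕ (monomial s) (monomials L) i j ⟩
  Step (monomial s) i j +ℤ Step (monomials L) i j                      ≡⟨ cong₂ _+ℤ_ (Step-monomial s i j) (Step-monomials L i j) ⟩
  monomials (successors s) i j +ℤ monomials (concatMap successors L) i j ≡⟨ monomials-++ (successors s) (concatMap successors L) i j ⟨
  monomials (concatMap successors (s ∷ L)) i j                         ∎
  where open ≡-Reasoning

sum-excursions-suc : ∀ r L → sum (map (excursions r) (concatMap successors L)) ≡ sum (map (excursions (suc r)) L)
sum-excursions-suc r []      = refl
sum-excursions-suc r (s ∷ L) = begin
  sum (map (excursions r) (successors s ++ concatMap successors L))    ≡⟨ cong sum (map-++ (excursions r) (successors s) _) ⟩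
  sum (map (excursions r) (successors s) ++ map (excursions r) (concatMap successors L))
    ≡⟨ sum-++ (map (excursions r) (successors s)) _ ⟩
  excursions (suc r) s + sum (map (excursions r) (concatMap successors L)) ≡⟨ cong (_+_ (excursions (suc r) s)) (sum-excursions-suc r L) ⟩
  excursions (suc r) s + sum (map (excursions (suc r)) L)              ∎
  where open ≡-Reasoning

-- `iterStep` extends walks at their end, `excursions` unfolds them from their start. Peeling off
-- the innermost `Step` reconciles the two: it replaces the list of current states by all their
-- successors.
iterStep-monomials : ∀ r p L → p ≗₂ monomials L → iterStep r p 0 0 ≡ + sum (map (excursions r) L)
iterStep-monomials zero    p L eq = trans (eq 0 0) (constants L)
  where
  constants : ∀ L → monomials L 0 0 ≡ + sum (map (excursions 0) L)
  constants []                  = refl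
  constants ((zero  , zero)  ∷ L) = cong (1ℤ +ℤ_) (constants L)
  constants ((zero  , suc b) ∷ L) = trans (ℤ.+-identityˡ _) (constants L)
  constants ((suc a , b)     ∷ L) = trans (ℤ.+-identityˡ _) (constants L)
iterStep-monomials (suc r) p L eq = begin
  iterStep (suc r) p 0 0                                     ≡⟨ cong (λ q → q 0 0) (iterStep-Step r p) ⟨
  iterStep r (Step p) 0 0                                    ≡⟨ iterStep-monomials r (Step p) (concatMap successors L)
                                                                  (λ i j → trans (Step-cong eq i j) (Step-monomials L i j)) ⟩
  + sum (map (excursions r) (concatMap successors L))        ≡⟨ cong +_ (sum-excursions-suc r L) ⟩
  + sum (map (excursions (suc r)) L)                         ∎
  where open ≡-Reasoning

walks≡excursions : ∀ m → walks m 0 0 ≡ + excursions m (0 , 0)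
walks≡excursions m = trans (iterStep-monomials m oneP [ 0 , 0 ] start) (cong +_ (ℕ.+-identityʳ _))
  where
  start : oneP ≗₂ monomials [ 0 , 0 ]
  start zero    zero    = refl
  start zero    (suc j) = refl
  start (suc i) j       = refl

-- Counting partial matchings by state

HasCard-⇔ : ∀ {A} {P Q : A → Set} {N} → (∀ a → P a ⇔ Q a) → HasCard P N → HasCard Q N
HasCard-⇔ P⇔Q (xs , uniq , char , len) = xs , uniq , (λ a → mk⇔
  (λ a∈xs → Equivalence.to (P⇔Q a) (Equivalence.to (char a) a∈xs))
  (λ q → Equivalence.from (char a) (Equivalence.from (P⇔Q a) q))) , len

HasCard-∅ : ∀ {A} {P : A → Set} → (∀ a → ¬ P a) → HasCard P 0
HasCard-∅ ¬P = [] , [] , (λ a → mk⇔ (λ ()) (λ p → ⊥-elim (¬P a p))) , refl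

HasCard-⊎ : ∀ {A} {P Q : A → Set} {M N} → (∀ a → P a → ¬ Q a) →
  HasCard P M → HasCard Q N → HasCard (λ a → P a ⊎ Q a) (M + N)
HasCard-⊎ disjoint (xs , ux , cx , refl) (ys , uy , cy , refl) =
  xs ++ ys ,
  ++⁺ ux uy (λ {a} (a∈xs , a∈ys) → disjoint a (Equivalence.to (cx a) a∈xs) (Equivalence.to (cy a) a∈ys)) ,
  (λ a → mk⇔
    (λ a∈ → [ (λ m → inj₁ (Equivalence.to (cx a) m)) , (λ m → inj₂ (Equivalence.to (cy a) m)) ]′ (∈-++⁻ xs a∈))
    [ (λ p → ∈-++⁺ˡ (Equivalence.from (cx a) p)) , (λ q → ∈-++⁺ʳ xs (Equivalence.from (cy a) q)) ]′) ,
  length-++ xs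

-- Preimages of the enumerated elements are chosen one by one; the equation `map g ys ≡ xs` then
-- carries uniqueness and length back to `ys`, and injectivity on `Q` gives completeness.
HasCard-bijection : ∀ {A B} {P : A → Set} {Q : B → Set} {N} (g : B → A) →
  (∀ b → Q b → P (g b)) →
  (∀ {b b'} → Q b → Q b' → g b ≡ g b' → b ≡ b') →
  (∀ a → P a → Σ B λ b → Q b × g b ≡ a) →
  HasCard P N → HasCard Q N
HasCard-bijection {A} {B} {P} {Q} g g-P g-inj g-surj (xs , uniq , char , refl) =
  ys , map⁻ (subst Unique (sym eq) uniq) , char' , trans (sym (length-map g ys)) (cong length eq)
  where
  preimages : ∀ {xs} → All P xs → Σ (List B) λ ys → All Q ys × map g ys ≡ xs
  preimages []       = [] , [] , refl
  preimages (p ∷ ps) with g-surj _ p | preimages ps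
  ... | y , q , refl | ys , qs , refl = y ∷ ys , q ∷ qs , refl
  pre = preimages {xs} (All.tabulate λ {a} → Equivalence.to (char a))
  ys  = proj₁ pre
  eq  = proj₂ (proj₂ pre)
  all-Q : ∀ {b} → b ∈ ys → Q b
  all-Q = All.lookup (proj₁ (proj₂ pre))
  char' : ∀ b → (b ∈ ys) ⇔ Q b
  char' b = mk⇔ all-Q from
    where
    from : Q b → b ∈ ys
    from q with ∈-map⁻ g (subst (g b ∈_) (sym eq) (Equivalence.from (char (g b)) (g-P b q)))
    ... | b' , b'∈ys , gb≡gb' = subst (_∈ ys) (g-inj (all-Q b'∈ys) q (sym gb≡gb')) b'∈ys

-- Ranks among marked points

increment-if : Bool → ℕ → ℕ
increment-if true  n = suc n
increment-if false n = n

-- The bound is a natural number so that `rank χ (toℕ x)` is the rank of a point and `rank χ r` the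
-- total.
rank : ∀ {r} → (Fin r → Bool) → ℕ → ℕ
rank {zero}  χ k       = 0
rank {suc r} χ zero    = 0
rank {suc r} χ (suc k) = increment-if (χ zero) (rank (λ x → χ (suc x)) k)

rank-cong : ∀ {r} {χ ψ : Fin r → Bool} k → (∀ x → χ x ≡ ψ x) → rank χ k ≡ rank ψ k
rank-cong {zero}  k       e = refl
rank-cong {suc r} zero    e = refl
rank-cong {suc r} (suc k) e = cong₂ increment-if (e zero) (rank-cong k (λ x → e (suc x)))

rank-mono : ∀ {r} (χ : Fin r → Bool) {k l} → k ≤ l → rank χ k ≤ rank χ l
rank-mono {zero}  χ k≤l = z≤n
rank-mono {suc r} χ z≤n = z≤n
rank-mono {suc r} χ (s≤s k≤l) with χ zero
... | true  = s≤s (rank-mono (λ x → χ (suc x)) k≤l)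
... | false = rank-mono (λ x → χ (suc x)) k≤l

rank-strict : ∀ {r} (χ : Fin r → Bool) x {k} → χ x ≡ true → toℕ x < k → rank χ (toℕ x) < rank χ k
rank-strict χ zero    t (s≤s _) rewrite t = s≤s z≤n
rank-strict χ (suc x) t (s≤s x<k) with χ zero
... | true  = s≤s (rank-strict (λ x → χ (suc x)) x t x<k)
... | false = rank-strict (λ x → χ (suc x)) x t x<k

rank-cancel-< : ∀ {r} (χ : Fin r → Bool) {k l} → rank χ k < rank χ l → k < l
rank-cancel-< χ lt = ℕ.≰⇒> (λ l≤k → ℕ.<⇒≱ lt (rank-mono χ l≤k))

rank-injective : ∀ {r} (χ : Fin r → Bool) x y → χ x ≡ true → χ y ≡ true →
  rank χ (toℕ x) ≡ rank χ (toℕ y) → x ≡ y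
rank-injective χ x y tx ty e with Fin.<-cmp x y
... | tri< x<y _ _ = contradiction e (ℕ.<⇒≢ (rank-strict χ x tx x<y))
... | tri≈ _ x≡y _ = x≡y
... | tri> _ _ y<x = contradiction (sym e) (ℕ.<⇒≢ (rank-strict χ y ty y<x))

-- With `rank-injective`, a marked point and its rank determine each other; this recovers the
-- partner of a deleted opener from the state.
rank-select : ∀ {r} (χ : Fin r → Bool) {p k} → p < rank χ k →
  ∃[ x ] χ x ≡ true × toℕ x < k × rank χ (toℕ x) ≡ p
rank-select {suc r} χ {p} {suc k} lt with χ zero in t
rank-select {suc r} χ {zero}  {suc k} lt       | true = zero , t , s≤s z≤n , refl
rank-select {suc r} χ {suc p} {suc k} (s≤s lt) | true with rank-select (λ x → χ (suc x)) lt
... | x , tx , x<k , e = suc x , tx , s≤s x<k , trans (cong (λ b → increment-if b (rank (λ x → χ (suc x)) (toℕ x))) t) (cong suc e)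
rank-select {suc r} χ {p}     {suc k} lt       | false with rank-select (λ x → χ (suc x)) lt
... | x , tx , x<k , e = suc x , tx , s≤s x<k , trans (cong (λ b → increment-if b (rank (λ x → χ (suc x)) (toℕ x))) t) e

-- Used for the deletion of an opener with partner `y`, which makes `y` a new fixed point;
-- `rank-insert->` covers the bounds beyond `y`.
rank-insert-≤ : ∀ {r} {χ ψ : Fin r → Bool} y {k} → (∀ x → x ≢ y → ψ x ≡ χ x) →
  k ≤ toℕ y → rank ψ k ≡ rank χ k
rank-insert-≤ zero    e z≤n       = refl
rank-insert-≤ (suc y) e z≤n       = refl
rank-insert-≤ (suc y) e (s≤s k≤y) = cong₂ increment-if (e zero (λ ()))
  (rank-insert-≤ y (λ x x≢y → e (suc x) (λ q → x≢y (Fin.suc-injective q))) k≤y)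

rank-insert-> : ∀ {r} {χ ψ : Fin r → Bool} y {k} → χ y ≡ false → ψ y ≡ true → (∀ x → x ≢ y → ψ x ≡ χ x) →
  toℕ y < k → rank ψ k ≡ suc (rank χ k)
rank-insert-> zero {suc k} f t e (s≤s _) rewrite f | t = cong suc (rank-cong k (λ x → e (suc x) (λ ())))
rank-insert-> {χ = χ} {ψ} (suc y) {suc k} f t e (s≤s y<k)
  rewrite e zero (λ ()) | rank-insert-> y f t (λ x x≢y → e (suc x) (λ q → x≢y (Fin.suc-injective q))) y<k
  with χ zero
... | true  = refl
... | false = refl

-- Partial matchings as involutions

Involutive : ∀ {r} → (Fin r → Fin r) → Set
Involutive F = ∀ x → F (F x) ≡ x

isFixed : ∀ {r} → (Fin r → Fin r) → Fin r → Bool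
isFixed F x = does (F x Fin.≟ x)

isFixed⁺ : ∀ {r} {F : Fin r → Fin r} {x} → F x ≡ x → isFixed F x ≡ true
isFixed⁺ {F = F} {x} = dec-true (F x Fin.≟ x)

isFixed⁻ : ∀ {r} {F : Fin r → Fin r} {x} → isFixed F x ≡ true → F x ≡ x
isFixed⁻ {F = F} {x} t with F x Fin.≟ x
... | yes e = e

fixedBelow : ∀ {r} → (Fin r → Fin r) → ℕ → ℕ
fixedBelow F = rank (isFixed F)

-- A fixed point of F is a closer whose opener lies to the left of all points of
-- Fin r; the external openers are ordered so that the closers of rank < b,
-- and those of rank ≥ b, are decreasing, with an ascent in between. Every arc
-- (c , F c) must separate each pair X < Y of closers pending at c whose openers
-- are in increasing order; the three fields are the possible kinds of such pairs.
-- In fix-fix the two closers next to the cut imply the condition for all others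
-- across it, so it does not matter which of these have openers in increasing order.
record Separating {r} (b : ℕ) (F : Fin r → Fin r) : Set where
  field
    arc-arc : ∀ {c X Y} → c Fin.< F c → c Fin.< X → X Fin.< Y →
      F X Fin.< F Y → F Y Fin.< c → X Fin.< F c × F c Fin.< Y
    fix-arc : ∀ {c X Y} → c Fin.< F c → c Fin.< X → X Fin.< Y →
      F X ≡ X → F Y Fin.< c → X Fin.< F c × F c Fin.< Y
    fix-fix : ∀ {c X Y} → c Fin.< F c → c Fin.< X → X Fin.< Y →
      F X ≡ X → F Y ≡ Y → fixedBelow F (toℕ X) < b → b ≤ fixedBelow F (toℕ Y) → X Fin.< F c × F c Fin.< Y

record Partial {r} (s : State) (F : Fin r → Fin r) : Set where
  constructor mkPartial
  field
    involutive : Involutive F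
    fixedCount : fixedBelow F r ≡ proj₁ s
    separating : Separating (proj₂ s) F

-- Removing and adding the first point

record FixCons {r} (F : Fin (suc r) → Fin (suc r)) (f : Fin r → Fin r) : Set where
  constructor mkFixCons
  field
    head : F zero ≡ zero
    tail : ∀ x → F (suc x) ≡ suc (f x)

-- The new point 0 is an opener joined to the closer `y` that is pending in `f`. Being a relation,
-- it serves for both deletion and insertion, as `FixCons` does.
record ArcCons {r} (y : Fin r) (F : Fin (suc r) → Fin (suc r)) (f : Fin r → Fin r) : Set where
  constructor mkArcCons
  field
    head  : F zero ≡ suc y
    back  : F (suc y) ≡ zero
    fixed : f y ≡ y
    tail  : ∀ {x} → x ≢ y → F (suc x) ≡ suc (f x)

module _ {r} {F : Fin (suc r) → Fin (suc r)} {f : Fin r → Fin r} (FC : FixCons F f) where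
  open FixCons FC

  private
    fixedBelow-suc : ∀ k → fixedBelow F (suc k) ≡ suc (fixedBelow f k)
    fixedBelow-suc k = cong₂ increment-if (isFixed⁺ {F = F} head)
      (rank-cong k (λ x → cong (λ z → does (z Fin.≟ suc x)) (tail x)))

  FixCons-¬empty : ∀ {b} → ¬ Partial (0 , b) F
  FixCons-¬empty P with trans (sym (fixedBelow-suc r)) (Partial.fixedCount P)
  ... | ()

  -- The conditions require c < X < Y, so they never concern a fixed point at 0. Removing it lowers
  -- all later ranks by one, and with them the cut.
  FixCons-uncons : ∀ {a b} → Partial (suc a , b) F → Partial (a , pred b) f
  FixCons-uncons {a} {b} P = mkPartial
    (λ x → Fin.suc-injective (trans (sym (tail (f x))) (trans (cong F (sym (tail x))) (involutive (suc x)))))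
    (ℕ.suc-injective (trans (sym (fixedBelow-suc r)) fixedCount))
    (record
      { arc-arc = λ {c} {X} {Y} c<fc c<X X<Y lt lt' → down c (arc-arc (up c c<fc) (s≤s c<X) (s≤s X<Y)
          (subst₂ Fin._<_ (sym (tail X)) (sym (tail Y)) (s≤s lt)) (subst (Fin._< suc c) (sym (tail Y)) (s≤s lt')))
      ; fix-arc = λ {c} {X} {Y} c<fc c<X X<Y fX lt' → down c (fix-arc (up c c<fc) (s≤s c<X) (s≤s X<Y)
          (trans (tail X) (cong suc fX)) (subst (Fin._< suc c) (sym (tail Y)) (s≤s lt')))
      ; fix-fix = λ {c} {X} {Y} c<fc c<X X<Y fX fY lt le → down c (fix-fix (up c c<fc) (s≤s c<X) (s≤s X<Y)
          (trans (tail X) (cong suc fX)) (trans (tail Y) (cong suc fY))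
          (subst (_< b) (sym (fixedBelow-suc (toℕ X))) (<-pred b lt))
          (subst (b ≤_) (sym (fixedBelow-suc (toℕ Y))) (≤-pred b le)))
      })
    where
    open Partial P
    open Separating separating
    up : ∀ c → c Fin.< f c → suc c Fin.< F (suc c)
    up c lt = subst (suc c Fin.<_) (sym (tail c)) (s≤s lt)
    down : ∀ c {X Y : Fin r} → suc X Fin.< F (suc c) × F (suc c) Fin.< suc Y → X Fin.< f c × f c Fin.< Y
    down c {X} {Y} (l , l') = ℕ.≤-pred (subst (suc X Fin.<_) (tail c) l) , ℕ.≤-pred (subst (Fin._< suc Y) (tail c) l')
    <-pred : ∀ b {n} → n < pred b → suc n < b
    <-pred (suc b) lt = s≤s lt
    ≤-pred : ∀ b {n} → pred b ≤ n → b ≤ suc n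
    ≤-pred zero    _  = z≤n
    ≤-pred (suc b) le = s≤s le

  FixCons-cons : ∀ {a b} → Partial (a , pred b) f → Partial (suc a , b) F
  FixCons-cons {a} {b} P = mkPartial inv
    (trans (fixedBelow-suc r) (cong suc fixedCount))
    (record
      { arc-arc = λ { {zero} c<Fc → ⊥-elim (no-head c<Fc)
                    ; {suc c} {suc X} {suc Y} c<Fc (s≤s c<X) (s≤s X<Y) lt lt' → up c (arc-arc (down c c<Fc) c<X X<Y
                        (ℕ.≤-pred (subst₂ Fin._<_ (tail X) (tail Y) lt)) (ℕ.≤-pred (subst (Fin._< suc c) (tail Y) lt'))) }
      ; fix-arc = λ { {zero} c<Fc → ⊥-elim (no-head c<Fc)
                    ; {suc c} {suc X} {suc Y} c<Fc (s≤s c<X) (s≤s X<Y) FX lt' → up c (fix-arc (down c c<Fc) c<X X<Y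
                        (fix X FX) (ℕ.≤-pred (subst (Fin._< suc c) (tail Y) lt'))) }
      ; fix-fix = λ { {zero} c<Fc → ⊥-elim (no-head c<Fc)
                    ; {suc c} {suc X} {suc Y} c<Fc (s≤s c<X) (s≤s X<Y) FX FY lt le → up c (fix-fix (down c c<Fc) c<X X<Y
                        (fix X FX) (fix Y FY)
                        (ℕ.<⇒≤pred (subst (_< b) (fixedBelow-suc (toℕ X)) lt))
                        (ℕ.pred-mono-≤ (subst (b ≤_) (fixedBelow-suc (toℕ Y)) le))) }
      })
    where
    open Partial P
    open Separating separating
    inv : Involutive F
    inv zero    = trans (cong F head) head
    inv (suc x) = trans (cong F (tail x)) (trans (tail (f x)) (cong suc (involutive x)))
    no-head : ¬ zero {r} Fin.< F zero
    no-head lt rewrite head = contradiction lt (λ ())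
    fix : ∀ x → F (suc x) ≡ suc x → f x ≡ x
    fix x e = Fin.suc-injective (trans (sym (tail x)) e)
    down : ∀ c → suc c Fin.< F (suc c) → c Fin.< f c
    down c lt = ℕ.≤-pred (subst (suc c Fin.<_) (tail c) lt)
    up : ∀ c {X Y : Fin r} → X Fin.< f c × f c Fin.< Y → suc X Fin.< F (suc c) × F (suc c) Fin.< suc Y
    up c {X} {Y} (l , l') = subst (suc X Fin.<_) (sym (tail c)) (s≤s l) , subst (Fin._< suc Y) (sym (tail c)) (s≤s l')

module _ {r} {y : Fin r} {F : Fin (suc r) → Fin (suc r)} {f : Fin r → Fin r} (AC : ArcCons y F f) where
  open ArcCons AC

  private
    F₀≢0 : F zero ≢ zero
    F₀≢0 e with trans (sym e) head
    ... | ()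

    isFixed-tail : ∀ x → x ≢ y → isFixed f x ≡ isFixed F (suc x)
    isFixed-tail x x≢y = cong (λ z → does (z Fin.≟ suc x)) (sym (tail x≢y))

    not-fixed : ∀ {x} → F (suc x) ≡ suc x → x ≢ y
    not-fixed e refl with trans (sym e) back
    ... | ()

    fixedBelow-suc : ∀ k → fixedBelow F (suc k) ≡ rank (λ x → isFixed F (suc x)) k
    fixedBelow-suc k = cong (λ b → increment-if b (rank (λ x → isFixed F (suc x)) k)) (dec-false (F zero Fin.≟ zero) F₀≢0)

    fixedBelow-≤ : ∀ {k} → k ≤ toℕ y → fixedBelow f k ≡ fixedBelow F (suc k)
    fixedBelow-≤ le = trans (rank-insert-≤ y isFixed-tail le) (sym (fixedBelow-suc _))

    fixedBelow-> : ∀ {k} → toℕ y < k → fixedBelow f k ≡ suc (fixedBelow F (suc k))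
    fixedBelow-> lt = trans (rank-insert-> y (dec-false (F (suc y) Fin.≟ suc y) (λ e → not-fixed e refl))
      (isFixed⁺ {F = f} fixed) isFixed-tail lt) (cong suc (sym (fixedBelow-suc _)))

    fix : ∀ {x} → F (suc x) ≡ suc x → f x ≡ x
    fix e = Fin.suc-injective (trans (sym (tail (not-fixed e))) e)

    opener≢y : ∀ {c} → c Fin.< f c → c ≢ y
    opener≢y lt refl = ℕ.<⇒≢ lt (cong toℕ (sym fixed))

    closer≢y : ∀ {c X : Fin r} → f X Fin.< c → c Fin.< X → X ≢ y
    closer≢y l l' refl = ℕ.<⇒≢ (ℕ.<-trans l l') (cong toℕ fixed)

  -- Of the openers external to `f`, 0 is the last, so `y` is the maximum of the word and an ascent
  -- can only end at `y`. Hence the new cut is the rank of `y`.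
  ArcCons-uncons : ∀ {a b} → Partial (a , b) F → Partial (suc a , fixedBelow f (toℕ y)) f
  ArcCons-uncons {a} {b} P = mkPartial inv
    (trans (fixedBelow-> (Fin.toℕ<n y)) (cong suc fixedCount))
    (record { arc-arc = aa ; fix-arc = fa ; fix-fix = ff })
    where
    open Partial P
    open Separating separating
    inv : Involutive f
    inv x with x Fin.≟ y
    ... | yes refl = trans (cong f fixed) fixed
    ... | no x≢y   = Fin.suc-injective (trans (sym (tail fx≢y)) (trans (cong F (sym (tail x≢y))) (involutive (suc x))))
      where
      fx≢y : f x ≢ y
      fx≢y e with trans (sym (involutive (suc x))) (trans (cong F (trans (tail x≢y) (cong suc e))) back)
      ... | ()
    up : ∀ {c} → c Fin.< f c → suc c Fin.< F (suc c)
    up {c} lt = subst (suc c Fin.<_) (sym (tail (opener≢y lt))) (s≤s lt)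
    down : ∀ {c} {X Y : Fin r} → c Fin.< f c → suc X Fin.< F (suc c) × F (suc c) Fin.< suc Y → X Fin.< f c × f c Fin.< Y
    down {c} {X} {Y} lt (l , l') =
      ℕ.≤-pred (subst (suc X Fin.<_) (tail (opener≢y lt)) l) , ℕ.≤-pred (subst (Fin._< suc Y) (tail (opener≢y lt)) l')
    below-c : ∀ {c Y} → Y ≢ y → f Y Fin.< c → F (suc Y) Fin.< suc c
    below-c {c} Y≢y lt = subst (Fin._< suc c) (sym (tail Y≢y)) (s≤s lt)
    aa : ∀ {c X Y} → c Fin.< f c → c Fin.< X → X Fin.< Y → f X Fin.< f Y → f Y Fin.< c → X Fin.< f c × f c Fin.< Y
    aa {c} {X} {Y} c<fc c<X X<Y lt lt' = down c<fc (arc-arc (up c<fc) (s≤s c<X) (s≤s X<Y)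
        (subst₂ Fin._<_ (sym (tail X≢y)) (sym (tail Y≢y)) (s≤s lt)) (below-c Y≢y lt'))
      where
      X≢y = closer≢y {c} (ℕ.<-trans lt lt') c<X
      Y≢y = closer≢y {c} lt' (ℕ.<-trans c<X X<Y)
    fa : ∀ {c X Y} → c Fin.< f c → c Fin.< X → X Fin.< Y → f X ≡ X → f Y Fin.< c → X Fin.< f c × f c Fin.< Y
    fa {c} {X} {Y} c<fc c<X X<Y fX lt' with X Fin.≟ y
    ... | no X≢y   = down c<fc (fix-arc (up c<fc) (s≤s c<X) (s≤s X<Y) (trans (tail X≢y) (cong suc fX)) (below-c Y≢y lt'))
      where Y≢y = closer≢y {c} lt' (ℕ.<-trans c<X X<Y)
    -- In `F` the closer `y` belongs to the arc from 0, whose opener precedes that of `Y`, so the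
    -- pair falls under `arc-arc`.
    ... | yes refl = down c<fc (arc-arc (up c<fc) (s≤s c<X) (s≤s X<Y)
        (subst₂ Fin._<_ (sym back) (sym (tail Y≢y)) (s≤s z≤n)) (below-c Y≢y lt'))
      where Y≢y = closer≢y {c} lt' (ℕ.<-trans c<X X<Y)
    ff : ∀ {c X Y} → c Fin.< f c → c Fin.< X → X Fin.< Y → f X ≡ X → f Y ≡ Y →
      fixedBelow f (toℕ X) < fixedBelow f (toℕ y) → fixedBelow f (toℕ y) ≤ fixedBelow f (toℕ Y) → X Fin.< f c × f c Fin.< Y
    -- `y` is the first closer after the cut, so separating X from `y` suffices; in `F` that pair
    -- falls under `fix-arc`.
    ff {c} {X} {Y} c<fc c<X X<Y fX fY lt le = proj₁ X<fc<y , ℕ.<-≤-trans (proj₂ X<fc<y) y≤Y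
      where
      X<y : X Fin.< y
      X<y = rank-cancel-< (isFixed f) lt
      y≤Y : toℕ y ≤ toℕ Y
      y≤Y = ℕ.≮⇒≥ (λ Y<y → ℕ.<⇒≱ (rank-strict (isFixed f) Y (isFixed⁺ {F = f} fY) Y<y) le)
      X<fc<y : X Fin.< f c × f c Fin.< y
      X<fc<y = down c<fc (fix-arc (up c<fc) (s≤s c<X) (s≤s X<y)
        (trans (tail (λ e → ℕ.<⇒≢ X<y (cong toℕ e))) (cong suc fX)) (subst (Fin._< suc c) (sym back) (s≤s z≤n)))

  -- The arc at 0 has to separate the fixed points of ranks b - 1 and b.
  ArcCons-rank : ∀ {a b} → Partial (a , b) F → b ≤ pred a → b ≡ 0 ⊎ b ≡ fixedBelow f (toℕ y)
  ArcCons-rank {b = zero} P _ = inj₁ refl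
  ArcCons-rank {suc a} {suc b} P b<a = inj₂ (ℕ.≤-antisym lower upper)
    where
    open Partial P
    open Separating separating
    χ = isFixed F
    selX = rank-select χ {b} {suc r} (subst (b <_) (sym fixedCount) (ℕ.<-trans b<a (ℕ.n<1+n a)))
    selY = rank-select χ {suc b} {suc r} (subst (suc b <_) (sym fixedCount) (s≤s b<a))
    X = proj₁ selX
    Y = proj₁ selY
    FX : F X ≡ X
    FX = isFixed⁻ {F = F} (proj₁ (proj₂ selX))
    FY : F Y ≡ Y
    FY = isFixed⁻ {F = F} (proj₁ (proj₂ selY))
    rkX = proj₂ (proj₂ (proj₂ selX))
    rkY = proj₂ (proj₂ (proj₂ selY))
    positive : ∀ Z → F Z ≡ Z → zero {r} Fin.< Z
    positive zero    e = contradiction e F₀≢0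
    positive (suc Z) e = s≤s z≤n
    sep : X Fin.< F zero × F zero Fin.< Y
    sep = fix-fix (subst (zero {r} Fin.<_) (sym head) (s≤s z≤n)) (positive X FX)
      (rank-cancel-< χ (subst₂ _<_ (sym rkX) (sym rkY) (ℕ.n<1+n b))) FX FY
      (ℕ.≤-reflexive (cong suc rkX)) (ℕ.≤-reflexive (sym rkY))
    rk-y : fixedBelow f (toℕ y) ≡ fixedBelow F (toℕ (F zero))
    rk-y = trans (fixedBelow-≤ ℕ.≤-refl) (cong (λ z → fixedBelow F (toℕ z)) (sym head))
    lower : suc b ≤ fixedBelow f (toℕ y)
    lower = subst₂ _≤_ (cong suc rkX) (sym rk-y) (rank-strict χ X (isFixed⁺ {F = F} FX) (proj₁ sep))
    upper : fixedBelow f (toℕ y) ≤ suc b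
    upper = subst₂ _≤_ (sym rk-y) rkY (rank-mono χ (ℕ.<⇒≤ (proj₂ sep)))

  -- For positive `b` the closer `y` sits at the cut, so every pair across the cut of `F` encloses
  -- `y`: the arc from 0 separates it directly, later arcs by `fix-fix` for `f`. For `b` equal to 0
  -- there is no such pair.
  ArcCons-cons : ∀ {a b} → b ≡ 0 ⊎ b ≡ fixedBelow f (toℕ y) → Partial (suc a , fixedBelow f (toℕ y)) f → Partial (a , b) F
  ArcCons-cons {a} {b} b-rank P = mkPartial inv
    (ℕ.suc-injective (trans (sym (fixedBelow-> (Fin.toℕ<n y))) fixedCount))
    (record { arc-arc = aa ; fix-arc = fa ; fix-fix = ff })
    where
    open Partial P
    open Separating separating
    inv : Involutive F
    inv zero    = trans (cong F head) back
    inv (suc x) with x Fin.≟ y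
    ... | yes refl = trans (cong F back) head
    ... | no x≢y   = trans (cong F (tail x≢y)) (trans (tail fx≢y) (cong suc (involutive x)))
      where
      fx≢y : f x ≢ y
      fx≢y e = x≢y (trans (sym (involutive x)) (trans (cong f e) fixed))
    opener : ∀ {c} → suc c Fin.< F (suc c) → c ≢ y
    opener {c} lt refl = contradiction (subst (suc c Fin.<_) back lt) (λ ())
    down : ∀ {c} → suc c Fin.< F (suc c) → c Fin.< f c
    down {c} lt = ℕ.≤-pred (subst (suc c Fin.<_) (tail (opener lt)) lt)
    up : ∀ {c} {X Y : Fin r} → suc c Fin.< F (suc c) → X Fin.< f c × f c Fin.< Y → suc X Fin.< F (suc c) × F (suc c) Fin.< suc Y
    up {c} {X} {Y} lt (l , l') =
      subst (suc X Fin.<_) (sym (tail (opener lt))) (s≤s l) , subst (Fin._< suc Y) (sym (tail (opener lt))) (s≤s l')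
    below-c : ∀ {c Y} → Y ≢ y → F (suc Y) Fin.< suc c → f Y Fin.< c
    below-c {c} Y≢y lt = ℕ.≤-pred (subst (Fin._< suc c) (tail Y≢y) lt)
    aa : ∀ {c X Y} → c Fin.< F c → c Fin.< X → X Fin.< Y → F X Fin.< F Y → F Y Fin.< c → X Fin.< F c × F c Fin.< Y
    aa {suc c} {suc X} {suc Y} c<Fc (s≤s c<X) (s≤s X<Y) lt lt' with Y Fin.≟ y | X Fin.≟ y
    ... | yes refl | _      = contradiction (subst (F (suc X) Fin.<_) back lt) (λ ())
    ... | no Y≢y | yes refl = up c<Fc (fix-arc (down c<Fc) c<X X<Y fixed (below-c Y≢y lt'))
    ... | no Y≢y | no X≢y   = up c<Fc (arc-arc (down c<Fc) c<X X<Y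
      (ℕ.≤-pred (subst₂ Fin._<_ (tail X≢y) (tail Y≢y) lt)) (below-c Y≢y lt'))
    fa : ∀ {c X Y} → c Fin.< F c → c Fin.< X → X Fin.< Y → F X ≡ X → F Y Fin.< c → X Fin.< F c × F c Fin.< Y
    fa {suc c} {suc X} {suc Y} c<Fc (s≤s c<X) (s≤s X<Y) FX lt' with Y Fin.≟ y
    -- In `f` the closer `y` is pending and its rank is the cut, so X before `y` is a pair across
    -- the cut.
    ... | yes refl = up c<Fc (fix-fix (down c<Fc) c<X X<Y (fix FX) fixed
                       (rank-strict (isFixed f) X (isFixed⁺ {F = f} (fix FX)) X<Y) ℕ.≤-refl)
    ... | no Y≢y   = up c<Fc (fix-arc (down c<Fc) c<X X<Y (fix FX) (below-c Y≢y lt'))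
    around : ∀ {X Y} → F (suc X) ≡ suc X → F (suc Y) ≡ suc Y →
      fixedBelow F (suc (toℕ X)) < b → b ≤ fixedBelow F (suc (toℕ Y)) → X Fin.< y × y Fin.< Y
    around {X} {Y} FX FY lt le = X<y , ℕ.≤∧≢⇒< y≤Y (λ e → not-fixed FY (sym (Fin.toℕ-injective e)))
      where
      rk-y : b ≡ fixedBelow F (suc (toℕ y))
      rk-y = [ (λ b≡0 → contradiction (subst (fixedBelow F (suc (toℕ X)) <_) b≡0 lt) (λ ()))
             , (λ e → trans e (fixedBelow-≤ ℕ.≤-refl)) ]′ b-rank
      X<y : X Fin.< y
      X<y = ℕ.≤-pred (rank-cancel-< (isFixed F) (subst (fixedBelow F (suc (toℕ X)) <_) rk-y lt))
      y≤Y : toℕ y ≤ toℕ Y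
      y≤Y = ℕ.≮⇒≥ (λ Y<y → ℕ.<⇒≱ (rank-strict (isFixed F) (suc Y) (isFixed⁺ {F = F} FY) (s≤s Y<y))
        (subst (_≤ fixedBelow F (suc (toℕ Y))) rk-y le))
    ff : ∀ {c X Y} → c Fin.< F c → c Fin.< X → X Fin.< Y → F X ≡ X → F Y ≡ Y →
      fixedBelow F (toℕ X) < b → b ≤ fixedBelow F (toℕ Y) → X Fin.< F c × F c Fin.< Y
    ff {zero} {suc X} {suc Y} c<Fc c<X X<Y FX FY lt le with around FX FY lt le
    ... | X<y , y<Y = subst (suc X Fin.<_) (sym head) (s≤s X<y) , subst (Fin._< suc Y) (sym head) (s≤s y<Y)
    ff {suc c} {suc X} {suc Y} c<Fc (s≤s c<X) (s≤s X<Y) FX FY lt le with around FX FY lt le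
    ... | X<y , y<Y = up c<Fc (fix-fix (down c<Fc) c<X X<Y (fix FX) (fix FY)
      (rank-strict (isFixed f) X (isFixed⁺ {F = f} (fix FX)) X<y) (rank-mono (isFixed f) (ℕ.<⇒≤ y<Y)))

-- Deletion and insertion on vectors

drop : ∀ {r} → Fin r → Fin (suc r) → Fin r
drop x zero    = x
drop x (suc z) = z

-- Deletes the point 0; its partner, if any, becomes a fixed point.
rest : ∀ {r} → Vec (Fin (suc r)) (suc r) → Vec (Fin r) r
rest v = tabulate (λ x → drop x (lookup v (suc x)))

lookup-rest : ∀ {r} (v : Vec (Fin (suc r)) (suc r)) x → lookup (rest v) x ≡ drop x (lookup v (suc x))
lookup-rest v = lookup∘tabulate (λ x → drop x (lookup v (suc x)))

lookup-injective : ∀ {r} {A : Set} {v w : Vec A r} → (∀ x → lookup v x ≡ lookup w x) → v ≡ w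
lookup-injective {v = v} {w} e = trans (sym (tabulate∘lookup v)) (trans (tabulate-cong e) (tabulate∘lookup w))

rest-FixCons : ∀ {r} (v : Vec (Fin (suc r)) (suc r)) → Involutive (lookup v) →
  lookup v zero ≡ zero → FixCons (lookup v) (lookup (rest v))
rest-FixCons v inv h = mkFixCons h tail
  where
  tail : ∀ x → lookup v (suc x) ≡ suc (lookup (rest v) x)
  tail x with lookup v (suc x) in e | lookup-rest v x
  ... | suc z | e' = cong suc (sym e')
  ... | zero  | _ with trans (sym (inv (suc x))) (trans (cong (lookup v) e) h)
  ... | ()

rest-ArcCons : ∀ {r y} (v : Vec (Fin (suc r)) (suc r)) → Involutive (lookup v) →
  lookup v zero ≡ suc y → ArcCons y (lookup v) (lookup (rest v))
rest-ArcCons {y = y} v inv h = mkArcCons h back (trans (lookup-rest v y) (cong (drop y) back)) tail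
  where
  back : lookup v (suc y) ≡ zero
  back = trans (cong (lookup v) (sym h)) (inv zero)
  tail : ∀ {x} → x ≢ y → lookup v (suc x) ≡ suc (lookup (rest v) x)
  tail {x} x≢y with lookup v (suc x) in e | lookup-rest v x
  ... | suc z | e' = cong suc (sym e')
  ... | zero  | _  = contradiction (Fin.suc-injective (trans (sym (inv (suc x))) (trans (cong (lookup v) e) h))) x≢y

FixCons⇒rest : ∀ {r} (v : Vec (Fin (suc r)) (suc r)) w → FixCons (lookup v) (lookup w) → rest v ≡ w
FixCons⇒rest v w FC = lookup-injective λ x → trans (lookup-rest v x) (cong (drop x) (FixCons.tail FC x))

ArcCons⇒rest : ∀ {r y} (v : Vec (Fin (suc r)) (suc r)) w → ArcCons y (lookup v) (lookup w) → rest v ≡ w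
ArcCons⇒rest {y = y} v w AC = lookup-injective λ x → trans (lookup-rest v x) (go x)
  where
  go : ∀ x → drop x (lookup v (suc x)) ≡ lookup w x
  go x with x Fin.≟ y
  ... | yes refl = trans (cong (drop x) (ArcCons.back AC)) (sym (ArcCons.fixed AC))
  ... | no x≢y   = cong (drop x) (ArcCons.tail AC x≢y)

fixCons : ∀ {r} → Vec (Fin r) r → Vec (Fin (suc r)) (suc r)
fixCons w = zero ∷ Vec.map suc w

fixCons-FixCons : ∀ {r} (w : Vec (Fin r) r) → FixCons (lookup (fixCons w)) (lookup w)
fixCons-FixCons w = mkFixCons refl (λ x → lookup-map x suc w)

arcCons : ∀ {r} → Fin r → Vec (Fin r) r → Vec (Fin (suc r)) (suc r)
arcCons y w = suc y ∷ (Vec.map suc w [ y ]≔ zero)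

arcCons-ArcCons : ∀ {r} y (w : Vec (Fin r) r) → lookup w y ≡ y → ArcCons y (lookup (arcCons y w)) (lookup w)
arcCons-ArcCons y w e = mkArcCons refl (lookup∘update y (Vec.map suc w) zero) e
  (λ {x} x≢y → trans (lookup∘update′ x≢y (Vec.map suc w) zero) (lookup-map x suc w))

-- The recursion for the cardinalities

PartialVec : ∀ {r} → State → Vec (Fin r) r → Set
PartialVec s v = Partial s (lookup v)

HeadFixed HeadArc : ∀ {r} → State → Vec (Fin (suc r)) (suc r) → Set
HeadFixed s v = PartialVec s v × lookup v zero ≡ zero
HeadArc   s v = PartialVec s v × ∃[ y ] lookup v zero ≡ suc y

HeadArcRank : ∀ {r} → State → ℕ → Vec (Fin (suc r)) (suc r) → Set
HeadArcRank s p v = PartialVec s v × ∃[ y ] lookup v zero ≡ suc y × fixedBelow (lookup (rest v)) (toℕ y) ≡ p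

card-HeadFixed : ∀ {r a b N} → HasCard (PartialVec {r} (a , pred b)) N → HasCard (HeadFixed (suc a , b)) N
card-HeadFixed = HasCard-bijection rest
  (λ v (P , h) → FixCons-uncons (rest-FixCons v (Partial.involutive P) h) P)
  (λ {v} {v'} (P , h) (P' , h') e → lookup-injective λ
    { zero    → trans h (sym h')
    ; (suc x) → trans (FixCons.tail (rest-FixCons v (Partial.involutive P) h) x)
        (trans (cong (λ w → suc (lookup w x)) e) (sym (FixCons.tail (rest-FixCons v' (Partial.involutive P') h') x))) })
  (λ w P → fixCons w , (FixCons-cons (fixCons-FixCons w) P , refl) , FixCons⇒rest (fixCons w) w (fixCons-FixCons w))

-- `rest` forgets `y`, but `y` is the fixed point of rank `p` in the result, so `rest` is injective
-- once `p` is given. As `p ≤ a`, a point of that rank exists among the `suc a` fixed points.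
card-HeadArcRank : ∀ {r a b N} p → p ≤ a → b ≡ 0 ⊎ b ≡ p →
  HasCard (PartialVec {r} (suc a , p)) N → HasCard (HeadArcRank (a , b) p) N
card-HeadArcRank {r} {a} {b} p p≤a b-p = HasCard-bijection rest down inj surj
  where
  AC : ∀ {v y} → PartialVec (a , b) v → lookup v zero ≡ suc y → ArcCons y (lookup v) (lookup (rest v))
  AC {v} P h = rest-ArcCons v (Partial.involutive P) h
  down : ∀ v → HeadArcRank (a , b) p v → PartialVec (suc a , p) (rest v)
  down v (P , y , h , refl) = ArcCons-uncons (AC {v} P h) P
  inj : ∀ {v v'} → HeadArcRank (a , b) p v → HeadArcRank (a , b) p v' → rest v ≡ rest v' → v ≡ v'
  inj {v} {v'} (P , y , h , rk) (P' , y' , h' , rk') e = lookup-injective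
    λ { zero → trans h (trans (cong suc y≡y') (sym h')) ; (suc x) → tails x }
    where
    A = AC {v} P h
    A' = AC {v'} P' h'
    y≡y' : y ≡ y'
    y≡y' = rank-injective (isFixed (lookup (rest v))) y y'
      (isFixed⁺ {F = lookup (rest v)} (ArcCons.fixed A))
      (isFixed⁺ {F = lookup (rest v)} (subst (λ w → lookup w y' ≡ y') (sym e) (ArcCons.fixed A')))
      (trans rk (trans (sym rk') (cong (λ w → fixedBelow (lookup w) (toℕ y')) (sym e))))
    tails : ∀ x → lookup v (suc x) ≡ lookup v' (suc x)
    tails x with x Fin.≟ y
    ... | yes refl = trans (ArcCons.back A) (sym (subst (λ z → lookup v' (suc z) ≡ zero) (sym y≡y') (ArcCons.back A')))
    ... | no x≢y   = trans (ArcCons.tail A x≢y) (trans (cong (λ w → suc (lookup w x)) e)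
                       (sym (ArcCons.tail A' (λ x≡y' → x≢y (trans x≡y' (sym y≡y'))))))
  surj : ∀ w → PartialVec (suc a , p) w → Σ _ λ v → HeadArcRank (a , b) p v × rest v ≡ w
  surj w P with rank-select (isFixed (lookup w)) {p} {r} (subst (p <_) (sym (Partial.fixedCount P)) (s≤s p≤a))
  ... | y , fx , _ , refl = arcCons y w ,
    (ArcCons-cons A b-p P , y , refl , cong (λ u → fixedBelow (lookup u) (toℕ y)) rest≡w) , rest≡w
    where
    A = arcCons-ArcCons y w (isFixed⁻ {F = lookup w} fx)
    rest≡w = ArcCons⇒rest (arcCons y w) w A

-- The bound on `b` places a positive cut between two pending closers. Beyond it `fix-fix` would be
-- vacuous and the matchings would be those of cut 0, while `excursions` would differ in its
-- openings.
Cards : ℕ → Set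
Cards r = ∀ a b → b ≤ pred a → HasCard (PartialVec {r} (a , b)) (excursions r (a , b))

card-closings : ∀ {r} → Cards r → ∀ a b → b ≤ pred a →
  HasCard (HeadFixed {r} (a , b)) (sum (map (excursions r) (closings (a , b))))
card-closings ih zero b _ = HasCard-∅ λ v (P , h) →
  FixCons-¬empty (rest-FixCons v (Partial.involutive P) h) P
card-closings {r} ih (suc a) b b≤a = subst (HasCard _) (sym (ℕ.+-identityʳ _))
  (card-HeadFixed (ih a (pred b) (ℕ.pred-mono-≤ b≤a)))

HeadArc⇒rank : ∀ {r a b} (v : Vec (Fin (suc r)) (suc r)) (h : HeadArc (a , b) v) →
  fixedBelow (lookup (rest v)) (toℕ (proj₁ (proj₂ h))) ≤ a
HeadArc⇒rank {r} {a} v (P , y , h) = ℕ.≤-pred (subst (fixedBelow (lookup (rest v)) (toℕ y) <_)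
  (Partial.fixedCount (ArcCons-uncons A P))
  (rank-strict (isFixed (lookup (rest v))) y (isFixed⁺ {F = lookup (rest v)} (ArcCons.fixed A)) (Fin.toℕ<n y)))
  where A = rest-ArcCons v (Partial.involutive P) h

-- With cut 0 the partner of the point 0 may have any rank up to `a` in the rest, and the disjoint
-- union over these ranks follows `downFrom (suc a)`. With a positive cut, `ArcCons-rank` leaves a
-- single rank.
card-openings : ∀ {r} → Cards r → ∀ a b → b ≤ pred a →
  HasCard (HeadArc {r} (a , b)) (sum (map (excursions r) (openings (a , b))))
card-openings {r} ih a zero _ = HasCard-⇔
  (λ v → mk⇔ (λ (p , _ , P , y , h , _) → P , y , h)
             (λ H@(P , y , h) → _ , s≤s (HeadArc⇒rank v H) , P , y , h , refl))
  (ranks (suc a) ℕ.≤-refl)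
  where
  ranks : ∀ k → k ≤ suc a → HasCard (λ v → ∃[ p ] p < k × HeadArcRank (a , 0) p v)
    (sum (map (excursions r) (map (suc a ,_) (downFrom k))))
  ranks zero    _   = HasCard-∅ λ { v (p , () , _) }
  ranks (suc k) k≤a = HasCard-⇔
    (λ v → mk⇔ [ (λ H → k , ℕ.n<1+n k , H) , (λ (p , p<k , H) → p , ℕ.<-trans p<k (ℕ.n<1+n k) , H) ]′ (split v))
    (HasCard-⊎ disjoint (card-HeadArcRank k (ℕ.≤-pred k≤a) (inj₁ refl) (ih (suc a) k (ℕ.≤-pred k≤a)))
                        (ranks k (ℕ.≤-trans (ℕ.n≤1+n k) k≤a)))
    where
    split : ∀ v → (∃[ p ] p < suc k × HeadArcRank (a , 0) p v) →
      HeadArcRank (a , 0) k v ⊎ (∃[ p ] p < k × HeadArcRank (a , 0) p v)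
    split v (p , s≤s p≤k , H) with ℕ.m≤n⇒m<n∨m≡n p≤k
    ... | inj₁ p<k  = inj₂ (p , p<k , H)
    ... | inj₂ refl = inj₁ H
    disjoint : ∀ v → HeadArcRank (a , 0) k v → ¬ (∃[ p ] p < k × HeadArcRank (a , 0) p v)
    disjoint v (_ , y , h , refl) (p , p<k , _ , y' , h' , refl)
      with Fin.suc-injective (trans (sym h) h')
    ... | refl = ℕ.<-irrefl refl p<k
card-openings {r} ih a (suc b) b<a = subst (HasCard _) (sym (ℕ.+-identityʳ _)) (HasCard-⇔
  (λ v → mk⇔ (λ (P , y , h , _) → P , y , h)
             (λ (P , y , h) → P , y , h , sym ([ (λ ()) , (λ e → e) ]′
               (ArcCons-rank (rest-ArcCons v (Partial.involutive P) h) P b<a))))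
  (card-HeadArcRank (suc b) b<a' (inj₂ refl) (ih (suc a) (suc b) b<a')))
  where b<a' = ℕ.≤-trans b<a ℕ.pred[n]≤n

card-Partial : ∀ r → Cards r
card-Partial zero zero zero _ = [] ∷ [] , ([] ∷ []) ,
  (λ { [] → mk⇔ (λ _ → mkPartial (λ ()) refl (record
         { arc-arc = λ { {()} } ; fix-arc = λ { {()} } ; fix-fix = λ { {()} } })) (λ _ → here refl) }) , refl
card-Partial zero (suc a) b _ = HasCard-∅ λ { [] P → contradiction (Partial.fixedCount P) (λ ()) }
card-Partial (suc r) a b b≤a = subst (HasCard _)
  (sym (trans (cong sum (map-++ (excursions r) (openings (a , b)) (closings (a , b)))) (sum-++ (map (excursions r) (openings (a , b))) _)))
  (HasCard-⇔ (λ v → mk⇔ [ proj₁ , proj₁ ]′ (split v))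
    (HasCard-⊎ disjoint (card-openings (card-Partial r) a b b≤a) (card-closings (card-Partial r) a b b≤a)))
  where
  split : ∀ v → PartialVec (a , b) v → HeadArc (a , b) v ⊎ HeadFixed (a , b) v
  split v P = byHead (lookup v zero) refl
    where
    byHead : ∀ z → lookup v zero ≡ z → HeadArc (a , b) v ⊎ HeadFixed (a , b) v
    byHead zero    e = inj₂ (P , e)
    byHead (suc y) e = inj₁ (P , y , e)
  disjoint : ∀ v → HeadArc (a , b) v → ¬ HeadFixed (a , b) v
  disjoint v (_ , y , h) (_ , h') with trans (sym h) h'
  ... | ()

-- Pattern avoidance

monotone : ∀ {n m} (ι : Fin (suc n) → Fin m) → (∀ i → ι (inject₁ i) Fin.< ι (suc i)) → ∀ a b → a Fin.< b → ι a Fin.< ι b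
monotone {suc n} ι inc zero    (suc zero)    _ = inc zero
monotone {suc n} ι inc zero    (suc (suc b)) _ =
  Fin.<-trans (inc zero) (monotone (λ x → ι (suc x)) (λ i → inc (suc i)) zero (suc b) (s≤s z≤n))
monotone {suc n} ι inc (suc a) (suc b) (s≤s a<b) = monotone (λ x → ι (suc x)) (λ i → inc (suc i)) a b a<b

module _ {m} (v : Vec (Fin m) m) (inv : Involutive (lookup v)) where
  private F = lookup v

  -- For three arcs with openers F X < F Y < c and closers X < Y, the position of F c decides the
  -- pattern: before X it is 213, after Y it is 321. Only the place between them is left.
  ArcSeparating : Set
  ArcSeparating = ∀ {c X Y} → c Fin.< F c → c Fin.< X → X Fin.< Y →
    F X Fin.< F Y → F Y Fin.< c → X Fin.< F c × F c Fin.< Y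

  avoids⇒separating : Avoids p213 v → Avoids p321 v → ArcSeparating
  avoids⇒separating av213 av321 {c} {X} {Y} c<C c<X X<Y a<b b<c with Fin.<-cmp X (F c)
  ... | tri≈ _ refl _ = contradiction (cong toℕ (inv c)) (ℕ.<⇒≢ (Fin.<-trans a<b b<c))
  ... | tri> _ _ C<X  = ⊥-elim (av213 (lookup (F X ∷ F Y ∷ c ∷ F c ∷ X ∷ Y ∷ []) ,
    monotone _ (λ { zero → a<b ; (suc zero) → b<c ; (suc (suc zero)) → c<C
                  ; (suc (suc (suc zero))) → C<X ; (suc (suc (suc (suc zero)))) → X<Y }) ,
    λ { zero → inv X ; (suc zero) → inv Y ; (suc (suc zero)) → refl }))
  ... | tri< X<C _ _ with Fin.<-cmp (F c) Y
  ... | tri< C<Y _ _  = X<C , C<Y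
  ... | tri≈ _ refl _ = contradiction (cong toℕ (inv c)) (ℕ.<⇒≢ b<c)
  ... | tri> _ _ Y<C  = ⊥-elim (av321 (lookup (F X ∷ F Y ∷ c ∷ X ∷ Y ∷ F c ∷ []) ,
    monotone _ (λ { zero → a<b ; (suc zero) → b<c ; (suc (suc zero)) → c<X
                  ; (suc (suc (suc zero))) → X<Y ; (suc (suc (suc (suc zero)))) → Y<C }) ,
    λ { zero → inv X ; (suc zero) → inv Y ; (suc (suc zero)) → refl }))

  private
    partner : ∀ {x y} → F x ≡ y → F y ≡ x
    partner refl = inv _

    i₀ i₁ i₂ i₃ i₄ i₅ : Fin 6
    i₀ = zero
    i₁ = suc zero
    i₂ = suc (suc zero)
    i₃ = suc (suc (suc zero))
    i₄ = suc (suc (suc (suc zero)))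
    i₅ = suc (suc (suc (suc (suc zero))))

    <-resp : ∀ {x y : Fin m} → x Fin.< y → {x' y' : Fin m} → x ≡ x' → y ≡ y' → x' Fin.< y'
    <-resp lt refl refl = lt

  -- The last opener `ι i₂` plays c, and the closers of the first two arcs play X and Y. Here c
  -- closes at `ι i₃`, before X; in `separating⇒avoids321` it closes at `ι i₅`, after Y.
  separating⇒avoids213 : ArcSeparating → Avoids p213 v
  separating⇒avoids213 sep (ι , inc , arcs) = Fin.<-asym (inc i₃ i₄ ℕ.≤-refl)
    (<-resp (proj₁ (sep {ι i₂} {ι i₄} {ι i₅}
      (<-resp (inc i₂ i₃ ℕ.≤-refl) refl (sym (arcs (suc (suc zero))))) (inc i₂ i₄ (s≤s (s≤s (s≤s z≤n)))) (inc i₄ i₅ ℕ.≤-refl)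
      (<-resp (inc i₀ i₁ ℕ.≤-refl) (sym (partner (arcs zero))) (sym (partner (arcs (suc zero)))))
      (<-resp (inc i₁ i₂ ℕ.≤-refl) (sym (partner (arcs (suc zero)))) refl)))
      refl (arcs (suc (suc zero))))

  separating⇒avoids321 : ArcSeparating → Avoids p321 v
  separating⇒avoids321 sep (ι , inc , arcs) = Fin.<-asym (inc i₄ i₅ ℕ.≤-refl)
    (<-resp (proj₂ (sep {ι i₂} {ι i₃} {ι i₄}
      (<-resp (inc i₂ i₅ (s≤s (s≤s (s≤s z≤n)))) refl (sym (arcs (suc (suc zero))))) (inc i₂ i₃ ℕ.≤-refl) (inc i₃ i₄ ℕ.≤-refl)
      (<-resp (inc i₀ i₁ ℕ.≤-refl) (sym (partner (arcs zero))) (sym (partner (arcs (suc zero)))))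
      (<-resp (inc i₁ i₂ ℕ.≤-refl) (sym (partner (arcs (suc zero)))) refl)))
      (arcs (suc (suc zero))) refl)

-- In state (0 , 0) there are no fixed points, so `arc-arc` is the only condition with content, and
-- it amounts to avoiding both patterns.
Partial⇔InM : ∀ n (v : Vec (Fin (2 * n)) (2 * n)) → PartialVec (0 , 0) v ⇔ InM n v
Partial⇔InM n v = mk⇔ to from
  where
  F = lookup v
  to : PartialVec (0 , 0) v → InM n v
  to P = (λ x → involutive x , λ Fx≡x → ℕ.n≮0 (subst (fixedBelow F (toℕ x) <_) fixedCount
           (rank-strict (isFixed F) x (isFixed⁺ {F = F} Fx≡x) (Fin.toℕ<n x)))) ,
         separating⇒avoids213 v involutive arc-arc , separating⇒avoids321 v involutive arc-arc
    where
    open Partial P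
    open Separating separating
  from : InM n v → PartialVec (0 , 0) v
  from (pm , av213 , av321) = mkPartial inv noFixed (record
    { arc-arc = avoids⇒separating v inv av213 av321
    ; fix-arc = λ {_} {X} _ _ _ FX _ → contradiction FX (proj₂ (pm X))
    ; fix-fix = λ _ _ _ _ _ () })
    where
    inv : Involutive F
    inv x = proj₁ (pm x)
    noFixed : fixedBelow F (2 * n) ≡ 0
    noFixed with fixedBelow F (2 * n) in e
    ... | zero  = refl
    ... | suc k with rank-select (isFixed F) {0} {2 * n} (subst (0 <_) (sym e) (s≤s z≤n))
    ... | x , t , _ = contradiction (isFixed⁻ {F = F} t) (proj₂ (pm x))

theorem6p6 : (Σ Series λ G → IsPolySeries G × FunEq G)
    × (∀ (G : Series) → IsPolySeries G → FunEq G →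
    ∀ (n : ℕ) → Σ ℕ λ N → HasCard (InM n) N
    × (G (2 * n) 0 0 ≡ + N) × (G (suc (2 * n)) 0 0 ≡ 0ℤ))
-- Any solution has the coefficients of `walks`, so its even constant terms are counted by
-- `excursions` and its odd ones vanish by parity.
theorem6p6 = (walks , walks-IsPoly , walks-FunEq) , λ G _ eq n →
  excursions (2 * n) (0 , 0) ,
  HasCard-⇔ (Partial⇔InM n) (card-Partial (2 * n) 0 0 z≤n) ,
  trans (FunEq⇒walks G eq (2 * n) 0 0) (walks≡excursions (2 * n)) ,
  trans (FunEq⇒walks G eq (suc (2 * n)) 0 0) (walks-parity (suc (2 * n)) 0 0 (Odd-suc-2* n))
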